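{- Let $G$ be an abelian group, $H$ a subgroup of finite index $q=[G:H]$, and $\pi:G\to G/H$ the quotient homomorphism. Let $A\subseteq G$ be a finite set, and for each $k\in G/H$ let $n_k=|\pi^{ -1}(k)\cap A|$. If $|A|>256\sqrt{q}$ and $$\sum_{k\in G/H}n_k^2<\frac{|A|^3}{10^5q},$$ then $\pi(\Sigma^*(A))$ contains the identity of $G/H$.
   Context: For a finite set $A$ in an abelian group, $\Sigma^*(A)$ is the set of sums $\sum_{a\in A'}a$ over nonempty subsets $A'\subseteq A$. -}

module Defs where

open import Level using (Level; _⊔_)
open import Algebra.Bundles using (AbelianGroup)
open import Data.Nat using (ℕ; zero; suc; _+_; _*_)
open import Data.Fin using (Fin; zero; suc)
open import Data.Fin.Properties using (_≟_)
open import Data.Fin.Subset using (Subset; Nonempty)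
open import Data.Vec using (Vec; []; _∷_)
open import Data.Bool using (Bool; true; false)
open import Data.List using (List; length; filter; map; allFin)
open import Data.Nat.ListAction using (sum)
open import Data.Product using (_×_; Σ; ∃)
open import Function.Bundles using (_⇔_)
open import Relation.Binary.PropositionalEquality using (_≡_; _≢_)
open import Relation.Nullary using (¬_)

module _ {c ℓ : Level} (G : AbelianGroup c ℓ) where
  open AbelianGroup G

  record IsSubgroup {h : Level} (H : Carrier → Set h) : Set (c ⊔ ℓ ⊔ h) where
    field
      respects : ∀ {x y} → x ≈ y → H x → H y
      ε∈H      : H ε
      ∙-closed : ∀ {x y} → H x → H y → H (x ∙ y)
      ⁻¹-closed : ∀ {x} → H x → H (x ⁻¹)

  -- π : G → Fin q is (an encoding of) the quotient map G → G/H where the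
  -- q cosets of H are labelled bijectively by Fin q:
  -- π is surjective and π x ≡ π y iff x ∙ y⁻¹ ∈ H.
  -- This says precisely that [G : H] = q with G/H ≅ Fin q.
  record IsQuotientLabelling {h : Level} (H : Carrier → Set h) (q : ℕ)
                             (π : Carrier → Fin q) : Set (c ⊔ ℓ ⊔ h) where
    field
      surjective : ∀ (k : Fin q) → ∃ λ x → π x ≡ k
      same-coset : ∀ x y → (π x ≡ π y) ⇔ H (x ∙ y ⁻¹)

  -- A finite subset of G with n elements, given as an injective family.
  IsInjectiveFamily : {n : ℕ} → (Fin n → Carrier) → Set ℓ
  IsInjectiveFamily {n} a = ∀ (i j : Fin n) → i ≢ j → ¬ (a i ≈ a j)

  subsetSum : {n : ℕ} → Subset n → (Fin n → Carrier) → Carrier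
  subsetSum {zero}  []          a = ε
  subsetSum {suc n} (true  ∷ S) a = a zero ∙ subsetSum S (λ i → a (suc i))
  subsetSum {suc n} (false ∷ S) a = subsetSum S (λ i → a (suc i))

  fiberCount : {q n : ℕ} → (Carrier → Fin q) → (Fin n → Carrier) → Fin q → ℕ
  fiberCount {q} {n} π a k = length (filter (λ i → π (a i) ≟ k) (allFin n))

  sumSqFibers : {q n : ℕ} → (Carrier → Fin q) → (Fin n → Carrier) → ℕ
  sumSqFibers {q} π a = sum (map (λ k → fiberCount π a k * fiberCount π a k) (allFin q))

{-# OPTIONS --safe #-}
module Submission where

-- Work in the finite group K = G/H with the sequence of residues. For B ⊆ K let ∂ B g be the number
-- of elements of B moved out of B by g; it is symmetric and subadditive in g, and adjoining x to
-- a sequence with set of subset sums B enlarges that set by ∂ B x elements. If ∂ B ≤ u on a set of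
-- residues with s elements and N d = {g : ∂ B g ≤ d}, then either some N (m u) is closed under
-- translation by these residues, whose stabiliser is then a proper subgroup containing them all,
-- or |N (m u)| grows by s each time m grows by 3. The latter contradicts
-- Σ_g |B ∩ (B - g)| = |B|², which gives 2 |N d| ≤ 3 |B| when 3 d ≤ |B|.
-- By Cauchy–Schwarz the energy bound makes s large for every subsequence with 4/5 of the terms.
-- Hence either greedy growth yields two disjoint subsequences each having more than |K|/2 subset
-- sums, and for any further term x the element -x is a subset sum of their union; or 4/5 of the terms
-- lie in a subgroup of index at least 2, where the hypothesis persists as 2 (4/5)³ > 1.

open import Defs
open import Level using (Level)
open import Algebra.Bundles using (AbelianGroup)
open import Algebra.Core using (Op₁; Op₂)
import Algebra.Properties.AbelianGroup as AbelianGroupProperties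
import Algebra.Properties.CommutativeSemigroup as CommutativeSemigroupProperties
import Algebra.Solver.CommutativeMonoid as CommutativeMonoidSolver
open import Algebra.Structures using (IsAbelianGroup)
open import Data.Bool using (Bool; true; false; _∧_; _∨_; not; T; T?)
open import Data.Bool.Properties using (T-∧; T-∨; ∧-comm)
open import Data.Empty using (⊥; ⊥-elim)
open import Data.Fin using (Fin; zero; suc)
open import Data.Fin.Permutation using (permutation)
open import Data.Fin.Properties using (_≟_; any?)
open import Data.Fin.Subset using (Subset; Nonempty)
open import Data.List using (List; []; _∷_; _++_; [_]; length; map; foldr; filter; tabulate)
open import Data.List.Membership.Propositional using (_∈_; find; lose)
open import Data.List.Membership.Propositional.Properties using (∈-∃++; ∈-++⁺ʳ; ∈-++⁺ˡ; ∈-++⁻)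
open import Data.List.Properties using (++-assoc; length-tabulate)
open import Data.List.Relation.Binary.Permutation.Propositional as Perm
  using (_↭_; ↭-refl; ↭-sym; ↭-trans; ↭-reflexive; prep; swap)
open import Data.List.Relation.Binary.Permutation.Propositional.Properties
  using (shift; drop-∷; ↭-empty-inv; ↭-length; ∈-resp-↭; ++-comm; ++⁺ˡ; ++⁺ʳ; ++⁺; ++-commutativeMonoid)
open import Data.List.Relation.Unary.Any as Any using (here; there)
open import Data.Nat using (ℕ; zero; suc; NonZero; >-nonZero; _+_; _*_; _∸_; _≤_; _<_; _≤ᵇ_; _≡ᵇ_; z≤n; s≤s; s≤s⁻¹)
open import Data.Nat.DivMod using (_/_; m/n*n≤m; m≡m%n+[m/n]*n; m%n<n; m≥n⇒m/n>0)
open import Data.Nat.Induction using (Acc; acc; <-wellFounded)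
import Data.Nat.ListAction as ListAction
open import Data.Nat.Properties hiding (_≟_)
open import Data.Nat.Tactic.RingSolver using (solve-∀)
open import Data.Product using (∃; Σ; _×_; _,_; proj₁; proj₂)
open import Data.Sum using (_⊎_; inj₁; inj₂; [_,_]′)
open import Data.Unit using (tt)
open import Data.Vec as Vec using ([]; _∷_)
open import Function using (_∘_; id; Equivalence)
open import Relation.Binary.PropositionalEquality
  using (_≡_; refl; sym; trans; cong; cong₂; subst; subst₂; isEquivalence; module ≡-Reasoning)
open import Relation.Nullary using (¬_; yes; no; contradiction; does)
open import Relation.Nullary.Decidable using (⌊_⌋; decidable-stable; toWitness; fromWitness)
open import Algebra.Properties.CommutativeSemigroup +-commutativeSemigroup using (x∙yz≈y∙xz)
open import Algebra.Properties.Semiring.Sum +-*-semiring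
  using (sum; sum-cong-≗; ∑-distrib-+; ∑-comm; ∑-permute; *-distribˡ-sum; *-distribʳ-sum)

-- Finite sums and Boolean indicators.

sum-mono : ∀ {n} {f g : Fin n → ℕ} → (∀ i → f i ≤ g i) → sum f ≤ sum g
sum-mono {zero}  f≤g = z≤n
sum-mono {suc n} f≤g = +-mono-≤ (f≤g zero) (sum-mono (f≤g ∘ suc))

sum-term : ∀ {n} (f : Fin n → ℕ) i → f i ≤ sum f
sum-term f zero    = m≤m+n _ _
sum-term f (suc i) = m≤n⇒m≤o+n (f zero) (sum-term (f ∘ suc) i)

sum-zero : ∀ {n} {f : Fin n → ℕ} → (∀ i → f i ≡ 0) → sum f ≡ 0
sum-zero {zero}  f≡0 = refl
sum-zero {suc n} f≡0 = cong₂ _+_ (f≡0 zero) (sum-zero (f≡0 ∘ suc))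

-- Pigeonhole principle: if no index were strict, `sum-mono` would give the reverse inequality.
sum<⇒∃< : ∀ {n} {f g : Fin n → ℕ} → sum f < sum g → ∃ λ i → f i < g i
sum<⇒∃< {n} {f} {g} lt with any? (λ i → f i <? g i)
... | yes found = found
... | no  none  = contradiction lt (≤⇒≯ (sum-mono λ i → ≮⇒≥ λ fi<gi → none (i , fi<gi)))

𝟙 : Bool → ℕ
𝟙 true  = 1
𝟙 false = 0

𝟙-mono : ∀ x y → (T x → T y) → 𝟙 x ≤ 𝟙 y
𝟙-mono false y     _ = z≤n
𝟙-mono true  true  _ = ≤-refl
𝟙-mono true  false h = ⊥-elim (h tt)

-- Pointwise form of the bound |X| + |Y| ≤ |Z| for disjoint subsets X and Y of Z.
𝟙-disjoint : ∀ x y z → (T x → T z) → (T y → T z) → (T x → T y → ⊥) → 𝟙 x + 𝟙 y ≤ 𝟙 z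
𝟙-disjoint true  true  _     _ _ d = ⊥-elim (d tt tt)
𝟙-disjoint true  false z     h _ _ = 𝟙-mono true z h
𝟙-disjoint false y     z     _ h _ = 𝟙-mono y z h

𝟙-strict : ∀ x y → 𝟙 x < 𝟙 y → T y × ¬ T x
𝟙-strict false true _ = tt , λ ()
𝟙-strict true true (s≤s ())

∧-not-triangle : ∀ x y z → 𝟙 (x ∧ not z) ≤ 𝟙 (x ∧ not y) + 𝟙 (y ∧ not z)
∧-not-triangle false _     _     = z≤n
∧-not-triangle true  true  _     = ≤-refl
∧-not-triangle true  false false = ≤-refl
∧-not-triangle true  false true  = z≤n

∧-not-split : ∀ x y → 𝟙 (x ∧ not y) + 𝟙 (x ∧ y) ≡ 𝟙 x
∧-not-split false _     = refl
∧-not-split true  true  = refl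
∧-not-split true  false = refl

∨-split : ∀ x y → 𝟙 (x ∨ y) ≡ 𝟙 x + 𝟙 (y ∧ not x)
∨-split true  true  = refl
∨-split true  false = refl
∨-split false true  = refl
∨-split false false = refl

𝟙-∧ : ∀ x y → 𝟙 (x ∧ y) ≡ 𝟙 x * 𝟙 y
𝟙-∧ true  y = sym (*-identityˡ (𝟙 y))
𝟙-∧ false y = refl

∧⁺ : ∀ {x y} → T x → T y → T (x ∧ y)
∧⁺ tx ty = Equivalence.from T-∧ (tx , ty)

∧⁻ : ∀ {x y} → T (x ∧ y) → T x × T y
∧⁻ = Equivalence.to T-∧

T-not : ∀ {x} → T (not x) → ¬ T x
T-not {false} _ ()

¬T⇒T-not : ∀ {x} → ¬ T x → T (not x)
¬T⇒T-not {false} _ = tt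
¬T⇒T-not {true}  h = ⊥-elim (h tt)

∧-not-zero : ∀ {x y} → 𝟙 (x ∧ not y) ≡ 0 → T x → T y
∧-not-zero {true} {true} _ _ = tt

∧-not-zero⁺ : ∀ {x y} → (T x → T y) → 𝟙 (x ∧ not y) ≡ 0
∧-not-zero⁺ {false} {_}     _ = refl
∧-not-zero⁺ {true}  {true}  _ = refl
∧-not-zero⁺ {true}  {false} h = ⊥-elim (h tt)

sum-point : ∀ {n} (i : Fin n) → sum (λ k → 𝟙 (does (i ≟ k))) ≡ 1
sum-point {suc n} zero    = cong suc (sum-zero {n} λ _ → refl)
sum-point {suc n} (suc i) = sum-point i

-- Writing the larger number as the smaller plus `d` makes the two sides differ by exactly `d * d`,
-- without truncated subtraction.
2xy≤x²+y² : ∀ x y → 2 * x * y ≤ x * x + y * y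
2xy≤x²+y² x y with ≤-total x y
... | inj₁ x≤y with m≤n⇒∃[o]m+o≡n x≤y
...   | d , refl = m+n≤o⇒m≤o (2 * x * (x + d)) {d * d} (≤-reflexive (lemma x d))
  where
  lemma : ∀ x d → 2 * x * (x + d) + d * d ≡ x * x + (x + d) * (x + d)
  lemma = solve-∀
2xy≤x²+y² x y | inj₂ y≤x with m≤n⇒∃[o]m+o≡n y≤x
...   | d , refl = m+n≤o⇒m≤o (2 * (y + d) * y) {d * d} (≤-reflexive (lemma y d))
  where
  lemma : ∀ y d → 2 * (y + d) * y + d * d ≡ (y + d) * (y + d) + y * y
  lemma = solve-∀

sum-one : ∀ n → sum {n} (λ _ → 1) ≡ n
sum-one zero    = refl
sum-one (suc n) = cong suc (sum-one n)

sum-map-tabulate : ∀ {n} {A : Set} (g : A → ℕ) (f : Fin n → A) → ListAction.sum (map g (tabulate f)) ≡ sum (g ∘ f)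
sum-map-tabulate {zero}  g f = refl
sum-map-tabulate {suc n} g f = cong (g (f zero) +_) (sum-map-tabulate g (f ∘ suc))

-- Choice of the numerical parameters.

m<[1+m/n]*n : ∀ m n .{{_ : NonZero n}} → m < suc (m / n) * n
m<[1+m/n]*n m n = ≤-<-trans (≤-reflexive (m≡m%n+[m/n]*n m n)) (+-monoˡ-< (m / n * n) (m%n<n m n))

-- For positive `u`, let `suc r` be the integer quotient of `b` by `9 * u`: then `b` is below
-- `(2 + r) * (9 * u)`, and `2 + r` is at most `2 * suc r`. The two bounds are the premises of
-- `small-∂⇒halving`.
choose-radius : ∀ {b s u} → 1 ≤ b → 9 * u ≤ b → 27 * u < s →
                ∃ λ r → 9 * suc r * u ≤ b × 3 * b < 2 * (suc r * s)
-- No division by `9 * u` is possible here; the first bound is trivial, so any large enough `r`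
-- serves.
choose-radius {b} {s} {zero} 1≤b _ 0<s = 3 * b ,
  ≤-trans (≤-reflexive (*-zeroʳ (9 * suc (3 * b)))) z≤n ,
  (begin-strict
    3 * b                 <⟨ n<1+n (3 * b) ⟩
    suc (3 * b)           ≤⟨ m≤m*n (suc (3 * b)) s {{>-nonZero 0<s}} ⟩
    suc (3 * b) * s       ≤⟨ m≤n*m _ 2 ⟩
    2 * (suc (3 * b) * s) ∎)
  where open ≤-Reasoning
choose-radius {b} {s} {u@(suc _)} 1≤b 9u≤b 27u<s with b / (9 * u) | m≥n⇒m/n>0 9u≤b | m/n*n≤m b (9 * u) | m<[1+m/n]*n b (9 * u)
... | suc r | _ | lower | upper = r , ≤-trans (≤-reflexive (lemma₁ r u)) lower , (begin-strict
    3 * b                       <⟨ *-monoʳ-< 3 upper ⟩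
    3 * ((2 + r) * (9 * u))     ≤⟨ m+n≤o⇒m≤o _ {r * (27 * u)} (≤-reflexive (lemma₂ r u)) ⟩
    2 * (suc r * (27 * u))      ≤⟨ *-monoʳ-≤ 2 (*-monoʳ-≤ (suc r) (<⇒≤ 27u<s)) ⟩
    2 * (suc r * s)             ∎)
  where
  open ≤-Reasoning
  lemma₁ : ∀ r u → 9 * suc r * u ≡ suc r * (9 * u)
  lemma₁ = solve-∀
  lemma₂ : ∀ r u → 3 * ((2 + r) * (9 * u)) + r * (27 * u) ≡ 2 * (suc r * (27 * u))
  lemma₂ = solve-∀

m<n³⇒0<n : ∀ {m} n → m < n * n * n → 0 < n
m<n³⇒0<n (suc _) _ = s≤s z≤n

-- `n` is the length of a sequence, `k` the order of the subgroup that holds it and `E` its energy.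
module Parameters {n k E : ℕ} (1≤k : 1 ≤ k) (n≤E : n ≤ E) (100000kE<n³ : 100000 * k * E < n * n * n) where

  open ≤-Reasoning

  n≥1 : 1 ≤ n
  n≥1 = m<n³⇒0<n n 100000kE<n³

  private
    P = 100 * k
    instance
      n≢0 = >-nonZero n≥1

  1000PE<n³ : 1000 * P * E < n * n * n
  1000PE<n³ = ≤-<-trans (≤-reflexive (cong (_* E) (sym (*-assoc 1000 100 k)))) 100000kE<n³

  1000P<n² : 1000 * P < n * n
  1000P<n² = *-cancelʳ-< n _ _ (≤-<-trans (*-monoʳ-≤ (1000 * P) n≤E) 1000PE<n³)

  -- `u` is the number of elements that a useful term must exceed in enlarging the set of sums, `p`
  -- the number of terms reserved for each of four growth phases, and `c` the number left over, at
  -- least 4/5 of `n`.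
  u p c : ℕ
  u = P / n
  p = n / 25
  c = n ∸ 4 * p

  un≤P : u * n ≤ P
  un≤P = m/n*n≤m P n

  25p≤n : p * 25 ≤ n
  25p≤n = m/n*n≤m n 25

  -- After `p` steps of slow growth the set of sums has the size `9 * u` required for fast growth.
  -- The bound `1000 * P < n * n` forces `1000 * u < n`, so even `40 * u ≤ p`.
  9u≤p : 9 * u ≤ p
  9u≤p = ≤-trans (*-monoˡ-≤ u (≤ᵇ⇒≤ 9 40 tt)) (s≤s⁻¹ (*-cancelʳ-< 25 (40 * u) (suc p) (begin-strict
    40 * u * 25  ≡⟨ lemma u ⟩
    1000 * u     <⟨ *-cancelʳ-< n (1000 * u) n 1000un<n² ⟩
    n            <⟨ m<[1+m/n]*n n 25 ⟩
    suc p * 25   ∎)))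
    where
    lemma : ∀ u → 40 * u * 25 ≡ 1000 * u
    lemma = solve-∀
    1000un<n² : 1000 * u * n < n * n
    1000un<n² = begin-strict
      1000 * u * n     ≡⟨ *-assoc 1000 u n ⟩
      1000 * (u * n)   ≤⟨ *-monoʳ-≤ 1000 un≤P ⟩
      1000 * P         <⟨ 1000P<n² ⟩
      n * n            ∎

  1≤p : 1 ≤ p
  1≤p = m≥n⇒m/n>0 {n} {25} (≮⇒≥ λ n<25 → <-irrefl refl (begin-strict
    n * n       <⟨ *-mono-< {n} {25} {n} {25} n<25 n<25 ⟩
    625         ≤⟨ ≤ᵇ⇒≤ 625 1000 tt ⟩
    1000        ≤⟨ m≤m*n 1000 P {{>-nonZero (≤-trans 1≤k (m≤n*m k 100))}} ⟩
    1000 * P    <⟨ 1000P<n² ⟩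
    n * n       ∎))

  n≤50p : n ≤ 50 * p
  n≤50p = begin
    n                ≤⟨ <⇒≤ (m<[1+m/n]*n n 25) ⟩
    suc p * 25       ≤⟨ *-monoˡ-≤ 25 (+-monoˡ-≤ p 1≤p) ⟩
    (p + p) * 25     ≡⟨ lemma p ⟩
    50 * p           ∎
    where
    lemma : ∀ p → (p + p) * 25 ≡ 50 * p
    lemma = solve-∀

  -- Ensures that `p` terms, each adding at least `suc u` sums, pass half of a group of order `k`.
  -- It follows from `P < suc u * n` and `n ≤ 50 * p`.
  k<2p[1+u] : k < 2 * (p * suc u)
  k<2p[1+u] = *-cancelˡ-< 50 _ _ (begin-strict
    50 * k                  ≤⟨ *-monoˡ-≤ k (≤ᵇ⇒≤ 50 100 tt) ⟩
    P                       <⟨ m<[1+m/n]*n P n ⟩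
    suc u * n               ≤⟨ *-monoʳ-≤ (suc u) n≤50p ⟩
    suc u * (50 * p)        ≡⟨ lemma (suc u) p ⟩
    50 * (p * suc u)        ≤⟨ *-monoʳ-≤ 50 (m≤n*m (p * suc u) 2) ⟩
    50 * (2 * (p * suc u))  ∎)
    where
    lemma : ∀ v p → v * (50 * p) ≡ 50 * (p * v)
    lemma = solve-∀

  4p≤n : 4 * p ≤ n
  4p≤n = ≤-trans (*-monoˡ-≤ p (≤ᵇ⇒≤ 4 25 tt)) (≤-trans (≤-reflexive (*-comm 25 p)) 25p≤n)

  4p+c≤n : p + (p + (p + (p + c))) ≤ n
  4p+c≤n = ≤-reflexive (trans (lemma p c) (m+[n∸m]≡n 4p≤n))
    where
    lemma : ∀ p c → p + (p + (p + (p + c))) ≡ 4 * p + c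
    lemma = solve-∀

  module _ {l : ℕ} (c≤l : c ≤ l) where

    4n≤5l : 4 * n ≤ 5 * l
    4n≤5l = +-cancelˡ-≤ n _ _ (begin
      5 * n                ≤⟨ *-monoʳ-≤ 5 (≤-trans (m≤n+m∸n n (4 * p)) (+-monoʳ-≤ (4 * p) c≤l)) ⟩
      5 * (4 * p + l)      ≡⟨ lemma p l ⟩
      p * 20 + 5 * l       ≤⟨ +-monoˡ-≤ (5 * l) (≤-trans (*-monoʳ-≤ p (≤ᵇ⇒≤ 20 25 tt)) 25p≤n) ⟩
      n + 5 * l            ∎)
      where
      lemma : ∀ p l → 5 * (4 * p + l) ≡ p * 20 + 5 * l
      lemma = solve-∀

    1≤l : 1 ≤ l
    1≤l = *-cancelˡ-< 5 0 l (≤-trans (≤-trans n≥1 (m≤n*m n 4)) 4n≤5l)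

    -- The premise is Cauchy-Schwarz for `l` terms taking `s` distinct values. Were `s` at most
    -- `27 * u`, then 16 n³ ≤ 25 l² n ≤ 675 u n E, which `u * n ≤ P` puts below n³.
    27u<s : ∀ {s} → l * l ≤ s * E → 27 * u < s
    27u<s {s} l²≤sE = ≰⇒> λ s≤27u → <-irrefl refl (begin-strict
      16 * (n * n * n)          ≡⟨ lemma₁ n ⟩
      (4 * n) * (4 * n) * n     ≤⟨ *-monoˡ-≤ n (*-mono-≤ 4n≤5l 4n≤5l) ⟩
      (5 * l) * (5 * l) * n     ≡⟨ lemma₂ l n ⟩
      25 * (l * l) * n          ≤⟨ *-monoˡ-≤ n (*-monoʳ-≤ 25 (≤-trans l²≤sE (*-monoˡ-≤ E s≤27u))) ⟩
      25 * (27 * u * E) * n     ≡⟨ lemma₃ u E n ⟩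
      675 * (u * n) * E         ≤⟨ *-monoˡ-≤ E (*-mono-≤ (≤ᵇ⇒≤ 675 1000 tt) un≤P) ⟩
      1000 * P * E              <⟨ 1000PE<n³ ⟩
      n * n * n                 ≤⟨ m≤n*m (n * n * n) 16 ⟩
      16 * (n * n * n)          ∎)
      where
      lemma₁ : ∀ n → 16 * (n * n * n) ≡ (4 * n) * (4 * n) * n
      lemma₁ = solve-∀
      lemma₂ : ∀ l n → (5 * l) * (5 * l) * n ≡ 25 * (l * l) * n
      lemma₂ = solve-∀
      lemma₃ : ∀ u E n → 25 * (27 * u * E) * n ≡ 675 * (u * n) * E
      lemma₃ = solve-∀

    -- Cubing `4 * n ≤ 5 * l` costs the factor 125/64, while halving the order gains 2; the margin
    -- is 125 ≤ 128.
    hypothesis-inherited : ∀ {k′ E′} → 2 * k′ ≤ k → E′ ≤ E → 100000 * k′ * E′ < l * l * l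
    hypothesis-inherited {k′} {E′} 2k′≤k E′≤E = inherit 100000 100000kE<n³
      where
      lemma₁ : ∀ C k′ E′ → 128 * (C * k′ * E′) ≡ 64 * (C * (2 * k′) * E′)
      lemma₁ = solve-∀
      lemma₂ : ∀ n → 64 * (n * n * n) ≡ (4 * n) * (4 * n) * (4 * n)
      lemma₂ = solve-∀
      lemma₃ : ∀ l → (5 * l) * (5 * l) * (5 * l) ≡ 125 * (l * l * l)
      lemma₃ = solve-∀
      -- The constant 100000 becomes a variable, so that the algebra treats it as an atom.
      inherit : ∀ C → C * k * E < n * n * n → C * k′ * E′ < l * l * l
      inherit C CkE<n³ = *-cancelˡ-< 128 _ _ (begin-strict
        128 * (C * k′ * E′)              ≡⟨ lemma₁ C k′ E′ ⟩
        64 * (C * (2 * k′) * E′)         ≤⟨ *-monoʳ-≤ 64 (*-mono-≤ (*-monoʳ-≤ C 2k′≤k) E′≤E) ⟩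
        64 * (C * k * E)                 <⟨ *-monoʳ-< 64 CkE<n³ ⟩
        64 * (n * n * n)                 ≡⟨ lemma₂ n ⟩
        (4 * n) * (4 * n) * (4 * n)      ≤⟨ *-mono-≤ (*-mono-≤ 4n≤5l 4n≤5l) 4n≤5l ⟩
        (5 * l) * (5 * l) * (5 * l)      ≡⟨ lemma₃ l ⟩
        125 * (l * l * l)                ≤⟨ *-monoˡ-≤ (l * l * l) (≤ᵇ⇒≤ 125 128 tt) ⟩
        128 * (l * l * l)                ∎)

-- Translations and cardinalities in a finite abelian group.

module FiniteAbelianGroup {q : ℕ} {_∙_ : Op₂ (Fin q)} {ε : Fin q} {_⁻¹ : Op₁ (Fin q)}
  (isAbelianGroup : IsAbelianGroup _≡_ _∙_ ε _⁻¹) where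

  open IsAbelianGroup isAbelianGroup using (assoc; comm; identityˡ; identityʳ; inverseˡ; inverseʳ)

  x∙y∙y⁻¹≡x : ∀ x y → (x ∙ y) ∙ (y ⁻¹) ≡ x
  x∙y∙y⁻¹≡x x y = trans (assoc x y (y ⁻¹)) (trans (cong (x ∙_) (inverseʳ y)) (identityʳ x))

  x∙y⁻¹∙y≡x : ∀ x y → (x ∙ (y ⁻¹)) ∙ y ≡ x
  x∙y⁻¹∙y≡x x y = trans (assoc x (y ⁻¹) y) (trans (cong (x ∙_) (inverseˡ y)) (identityʳ x))

  reflect-involutive : ∀ c x → c ∙ ((c ∙ (x ⁻¹)) ⁻¹) ≡ x
  reflect-involutive c x = trans (cong (_∙ (y ⁻¹)) c≡x∙y) (x∙y∙y⁻¹≡x x y)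
    where
    y = c ∙ (x ⁻¹)
    c≡x∙y : c ≡ x ∙ y
    c≡x∙y = sym (trans (comm x y) (x∙y⁻¹∙y≡x c x))

  sum-translate : ∀ (f : Fin q → ℕ) g → sum (λ x → f (x ∙ g)) ≡ sum f
  sum-translate f g = sym (∑-permute f
    (permutation (_∙ g) (_∙ (g ⁻¹)) (λ x → x∙y⁻¹∙y≡x x g) (λ x → x∙y∙y⁻¹≡x x g)))

  sum-translateˡ : ∀ (f : Fin q → ℕ) g → sum (λ x → f (g ∙ x)) ≡ sum f
  sum-translateˡ f g = trans (sum-cong-≗ (λ x → cong f (comm g x))) (sum-translate f g)

  sum-reflect : ∀ (f : Fin q → ℕ) c → sum (λ x → f (c ∙ (x ⁻¹))) ≡ sum f
  sum-reflect f c = sym (∑-permute f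
    (permutation (λ x → c ∙ (x ⁻¹)) (λ x → c ∙ (x ⁻¹)) (reflect-involutive c) (reflect-involutive c)))

  open import Data.List.Membership.DecPropositional (_≟_ {q}) using (_∈?_)

  FinSet : Set
  FinSet = Fin q → Bool

  card : FinSet → ℕ
  card B = sum (𝟙 ∘ B)

  card-mono : ∀ {A B : FinSet} → (∀ x → T (A x) → T (B x)) → card A ≤ card B
  card-mono {A} {B} A⊆B = sum-mono λ x → 𝟙-mono (A x) (B x) (A⊆B x)

  card< : ∀ {A B : FinSet} → card A < card B → ∃ λ x → T (B x) × ¬ T (A x)
  card< {A} {B} lt with sum<⇒∃< {f = 𝟙 ∘ A} {g = 𝟙 ∘ B} lt
  ... | x , p = x , 𝟙-strict (A x) (B x) p

  -- Displacement of a set under translation.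

  ∂ : FinSet → Fin q → ℕ
  ∂ B g = sum λ b → 𝟙 (B b ∧ not (B (b ∙ g)))

  kept : FinSet → Fin q → ℕ
  kept B g = sum λ b → 𝟙 (B b ∧ B (b ∙ g))

  ∂-+-kept : ∀ B g → ∂ B g + kept B g ≡ card B
  ∂-+-kept B g = trans (sym (∑-distrib-+ {q} _ _))
    (sum-cong-≗ λ b → ∧-not-split (B b) (B (b ∙ g)))

  -- An element expelled by `g ∙ h` is either expelled by `g`, or stays in `B` under `g` and is then
  -- expelled by `h`.
  ∂-triangle : ∀ B g h → ∂ B (g ∙ h) ≤ ∂ B g + ∂ B h
  ∂-triangle B g h = begin
    ∂ B (g ∙ h)                       ≤⟨ sum-mono pointwise ⟩
    sum (λ b → 𝟙 (B b ∧ not (B (b ∙ g))) + 𝟙 (B (b ∙ g) ∧ not (B ((b ∙ g) ∙ h))))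
                                      ≡⟨ ∑-distrib-+ {q} _ _ ⟩
    ∂ B g + sum (λ b → 𝟙 (B (b ∙ g) ∧ not (B ((b ∙ g) ∙ h))))
                                      ≡⟨ cong (∂ B g +_) (sum-translate (λ b → 𝟙 (B b ∧ not (B (b ∙ h)))) g) ⟩
    ∂ B g + ∂ B h                     ∎
    where
    open ≤-Reasoning
    pointwise : ∀ b → 𝟙 (B b ∧ not (B (b ∙ (g ∙ h)))) ≤
                      𝟙 (B b ∧ not (B (b ∙ g))) + 𝟙 (B (b ∙ g) ∧ not (B ((b ∙ g) ∙ h)))
    pointwise b rewrite sym (assoc b g h) = ∧-not-triangle (B b) (B (b ∙ g)) _

  ∂-ε : ∀ B → ∂ B ε ≡ 0
  ∂-ε B = sum-zero λ b → ∧-not-zero⁺ (subst (T ∘ B) (sym (identityʳ b)))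

  -- Split the `card B` points `b` with `b ∙ g` in `B` according to whether `b` lies in `B`: those
  -- inside are counted by `kept B g`, those outside by `∂ B (g ⁻¹)`.
  ∂-inv : ∀ B g → ∂ B (g ⁻¹) ≡ ∂ B g
  ∂-inv B g = +-cancelʳ-≡ (kept B g) (∂ B (g ⁻¹)) (∂ B g) (begin
    ∂ B (g ⁻¹) + kept B g
      ≡⟨ cong (_+ kept B g) (sym (sum-translate (λ b → 𝟙 (B b ∧ not (B (b ∙ (g ⁻¹))))) g)) ⟩
    sum (λ b → 𝟙 (B (b ∙ g) ∧ not (B ((b ∙ g) ∙ (g ⁻¹))))) + kept B g
      ≡⟨ sym (∑-distrib-+ {q} _ _) ⟩
    sum (λ b → 𝟙 (B (b ∙ g) ∧ not (B ((b ∙ g) ∙ (g ⁻¹)))) + 𝟙 (B b ∧ B (b ∙ g)))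
      ≡⟨ sum-cong-≗ pointwise ⟩
    sum (λ b → 𝟙 (B (b ∙ g)))
      ≡⟨ sum-translate (𝟙 ∘ B) g ⟩
    card B
      ≡⟨ sym (∂-+-kept B g) ⟩
    ∂ B g + kept B g ∎)
    where
    open ≡-Reasoning
    pointwise : ∀ b → 𝟙 (B (b ∙ g) ∧ not (B ((b ∙ g) ∙ (g ⁻¹)))) + 𝟙 (B b ∧ B (b ∙ g)) ≡ 𝟙 (B (b ∙ g))
    pointwise b rewrite x∙y∙y⁻¹≡x b g | ∧-comm (B b) (B (b ∙ g)) = ∧-not-split (B (b ∙ g)) (B b)

  -- Double counting: a pair of elements of `B` determines the translation from the first to the
  -- second.
  sum-kept : ∀ B → sum (kept B) ≡ card B * card B
  sum-kept B = begin
    sum (λ g → sum λ b → 𝟙 (B b ∧ B (b ∙ g)))  ≡⟨ ∑-comm {q} {q} (λ g b → 𝟙 (B b ∧ B (b ∙ g))) ⟩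
    sum (λ b → sum λ g → 𝟙 (B b ∧ B (b ∙ g)))  ≡⟨ sum-cong-≗ inner ⟩
    sum (λ b → 𝟙 (B b) * card B)               ≡⟨ sym (*-distribʳ-sum (card B) (𝟙 ∘ B)) ⟩
    card B * card B                            ∎
    where
    open ≡-Reasoning
    inner : ∀ b → sum (λ g → 𝟙 (B b ∧ B (b ∙ g))) ≡ 𝟙 (B b) * card B
    inner b = begin
      sum (λ g → 𝟙 (B b ∧ B (b ∙ g)))    ≡⟨ sum-cong-≗ (λ g → 𝟙-∧ (B b) (B (b ∙ g))) ⟩
      sum (λ g → 𝟙 (B b) * 𝟙 (B (b ∙ g))) ≡⟨ sym (*-distribˡ-sum (𝟙 (B b)) (λ g → 𝟙 (B (b ∙ g)))) ⟩
      𝟙 (B b) * sum (λ g → 𝟙 (B (b ∙ g))) ≡⟨ cong (𝟙 (B b) *_) (sum-translateˡ (𝟙 ∘ B) b) ⟩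
      𝟙 (B b) * card B                   ∎

  -- Subgroups, stabilisers and almost periods.

  record IsSubgroupSet (K : FinSet) : Set where
    field
      ε-mem : T (K ε)
      ∙-mem : ∀ {x y} → T (K x) → T (K y) → T (K (x ∙ y))
      ⁻¹-mem : ∀ {x} → T (K x) → T (K (x ⁻¹))

  card-subgroup>0 : ∀ {K} → IsSubgroupSet K → 1 ≤ card K
  card-subgroup>0 {K} K-sub = ≤-trans (𝟙-mono true (K ε) λ _ → IsSubgroupSet.ε-mem K-sub) (sum-term (𝟙 ∘ K) ε)

  record Halving (K : FinSet) (R : List (Fin q)) : Set where
    field
      subgroup : FinSet
      isSubgroupSet : IsSubgroupSet subgroup
      members : ∀ {x} → x ∈ R → T (subgroup x)
      halved : 2 * card subgroup ≤ card K

  -- For `w` in `K` outside `K′`, the coset of `w` is disjoint from `K′`, of the same size, and also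
  -- inside `K`.
  card-proper : ∀ {K′ K} → IsSubgroupSet K′ → IsSubgroupSet K → (∀ x → T (K′ x) → T (K x)) →
                card K′ < card K → 2 * card K′ ≤ card K
  card-proper {K′} {K} K′-sub K-sub K′⊆K lt with card< {K′} {K} lt
  ... | w , w∈K , w∉K′ = begin
    2 * card K′                                     ≡⟨ cong (card K′ +_) (+-identityʳ (card K′)) ⟩
    card K′ + card K′                               ≡⟨ cong (card K′ +_) (sym (sum-translate (𝟙 ∘ K′) (w ⁻¹))) ⟩
    card K′ + sum (λ x → 𝟙 (K′ (x ∙ (w ⁻¹))))       ≡⟨ sym (∑-distrib-+ {q} _ _) ⟩
    sum (λ x → 𝟙 (K′ x) + 𝟙 (K′ (x ∙ (w ⁻¹))))      ≤⟨ sum-mono pointwise ⟩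
    card K                                          ∎
    where
    open ≤-Reasoning
    module K′ = IsSubgroupSet K′-sub
    module K = IsSubgroupSet K-sub
    pointwise : ∀ x → 𝟙 (K′ x) + 𝟙 (K′ (x ∙ (w ⁻¹))) ≤ 𝟙 (K x)
    pointwise x = 𝟙-disjoint (K′ x) (K′ (x ∙ (w ⁻¹))) (K x) (K′⊆K x)
      (λ xw∈K′ → subst (T ∘ K) (x∙y⁻¹∙y≡x x w) (K.∙-mem (K′⊆K _ xw∈K′) w∈K))
      (λ x∈K′ xw∈K′ → w∉K′ (subst (T ∘ K′) (reflect-involutive x w) (K′.∙-mem x∈K′ (K′.⁻¹-mem xw∈K′))))

  -- Vanishing displacement means that `g` translates `N` into itself, hence onto itself by
  -- finiteness.
  stabiliser : FinSet → FinSet → FinSet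
  stabiliser K N g = K g ∧ (∂ N g ≡ᵇ 0)

  stabiliser⁺ : ∀ {K N g} → T (K g) → ∂ N g ≡ 0 → T (stabiliser K N g)
  stabiliser⁺ {K} {N} {g} g∈K ∂g≡0 = ∧⁺ {K g} g∈K (≡⇒≡ᵇ (∂ N g) 0 ∂g≡0)

  stabiliser⁻ : ∀ K N g → T (stabiliser K N g) → T (K g) × ∂ N g ≡ 0
  stabiliser⁻ K N g g∈ = let g∈K , ∂g≡0 = ∧⁻ {K g} g∈ in g∈K , ≡ᵇ⇒≡ (∂ N g) 0 ∂g≡0

  stabiliser-isSubgroupSet : ∀ {K} N → IsSubgroupSet K → IsSubgroupSet (stabiliser K N)
  stabiliser-isSubgroupSet {K} N K-sub = record
    { ε-mem = stabiliser⁺ {K} {N} K.ε-mem (∂-ε N)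
    ; ∙-mem = λ {x} {y} x∈ y∈ →
        let x∈K , ∂x≡0 = stabiliser⁻ K N x x∈ ; y∈K , ∂y≡0 = stabiliser⁻ K N y y∈ in
        stabiliser⁺ {K} {N} (K.∙-mem x∈K y∈K) (n≤0⇒n≡0
          (≤-trans (∂-triangle N x y) (≤-reflexive (cong₂ _+_ ∂x≡0 ∂y≡0))))
    ; ⁻¹-mem = λ {x} x∈ →
        let x∈K , ∂x≡0 = stabiliser⁻ K N x x∈ in
        stabiliser⁺ {K} {N} (K.⁻¹-mem x∈K) (trans (∂-inv N x) ∂x≡0)
    }
    where module K = IsSubgroupSet K-sub

  -- Since `N` contains `ε`, its stabiliser lies inside `N` and is therefore a proper subgroup of
  -- `K`; closure places every term of `R` in it.
  closed⇒halving : ∀ {K N R} → IsSubgroupSet K → (∀ {x} → x ∈ R → T (K x)) → T (N ε) →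
                   (∀ {g x} → T (N g) → x ∈ R → T (N (g ∙ x))) → card N < card K → Halving K R
  closed⇒halving {K} {N} {R} K-sub R⊆K ε∈N closed lt = record
    { subgroup = stabiliser K N
    ; isSubgroupSet = stab-sub
    ; members = λ x∈R → stabiliser⁺ {K} {N} (R⊆K x∈R) (sum-zero {q} λ g → ∧-not-zero⁺ {N g} λ g∈N → closed g∈N x∈R)
    ; halved = card-proper stab-sub K-sub (λ x → proj₁ ∘ stabiliser⁻ K N x)
                 (≤-<-trans (card-mono {stabiliser K N} {N} stab⊆N) lt)
    }
    where
    stab-sub = stabiliser-isSubgroupSet N K-sub
    stab⊆N : ∀ x → T (stabiliser K N x) → T (N x)
    stab⊆N x x∈ = subst (T ∘ N) (identityˡ x) (∧-not-zero {N ε} {N (ε ∙ x)}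
      (n≤0⇒n≡0 (≤-trans (sum-term (λ b → 𝟙 (N b ∧ not (N (b ∙ x)))) ε)
                        (≤-reflexive (proj₂ (stabiliser⁻ K N x x∈))))) ε∈N)

  -- Every `g` in `N` keeps at least two thirds of `B`, while all of the group together keeps
  -- `card B * card B` by `sum-kept`.
  almost-period-bound : ∀ B N → 1 ≤ card B → (∀ g → T (N g) → 3 * ∂ B g ≤ card B) →
                        2 * card N ≤ 3 * card B
  almost-period-bound B N B≢∅ small = *-cancelʳ-≤ (2 * card N) (3 * card B) (card B) {{>-nonZero B≢∅}} (begin
    2 * card N * card B                   ≡⟨ *-assoc 2 (card N) (card B) ⟩
    2 * (card N * card B)                 ≡⟨ cong (2 *_) (*-comm (card N) (card B)) ⟩
    2 * (card B * card N)                 ≡⟨ sym (*-assoc 2 (card B) (card N)) ⟩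
    2 * card B * card N                   ≡⟨ *-distribˡ-sum (2 * card B) (𝟙 ∘ N) ⟩
    sum (λ g → 2 * card B * 𝟙 (N g))      ≤⟨ sum-mono (λ g → pointwise g (N g) refl) ⟩
    sum (λ g → 3 * kept B g)              ≡⟨ sym (*-distribˡ-sum 3 (kept B)) ⟩
    3 * sum (kept B)                      ≡⟨ cong (3 *_) (sum-kept B) ⟩
    3 * (card B * card B)                 ≡⟨ sym (*-assoc 3 (card B) (card B)) ⟩
    3 * card B * card B                   ∎)
    where
    open ≤-Reasoning
    pointwise : ∀ g x → N g ≡ x → 2 * card B * 𝟙 x ≤ 3 * kept B g
    pointwise g false _ rewrite *-zeroʳ (2 * card B) = z≤n
    pointwise g true  e rewrite *-identityʳ (2 * card B) = +-cancelˡ-≤ (card B) _ _ (begin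
      3 * card B                      ≡⟨ cong (3 *_) (sym (∂-+-kept B g)) ⟩
      3 * (∂ B g + kept B g)          ≡⟨ *-distribˡ-+ 3 (∂ B g) (kept B g) ⟩
      3 * ∂ B g + 3 * kept B g        ≤⟨ +-monoˡ-≤ (3 * kept B g) (small g (subst T (sym e) tt)) ⟩
      card B + 3 * kept B g           ∎)

  support : List (Fin q) → FinSet
  support R x = ⌊ x ∈? R ⌋

  -- These are the balls around `ε` in `K` for the subadditive symmetric function `∂ B`.
  level : FinSet → FinSet → ℕ → FinSet
  level K B d g = K g ∧ (∂ B g ≤ᵇ d)

  level⁺ : ∀ {K B d g} → T (K g) → ∂ B g ≤ d → T (level K B d g)
  level⁺ {K} {g = g} g∈K ∂g≤d = ∧⁺ {K g} g∈K (≤⇒≤ᵇ ∂g≤d)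

  level⁻ : ∀ K B d g → T (level K B d g) → T (K g) × ∂ B g ≤ d
  level⁻ K B d g g∈ = let g∈K , ∂g≤d = ∧⁻ {K g} g∈ in g∈K , ≤ᵇ⇒≤ (∂ B g) d ∂g≤d

  support⁻ : ∀ R {x} → T (support R x) → x ∈ R
  support⁻ R {x} = toWitness {a? = x ∈? R}

  module _ {K B : FinSet} {R : List (Fin q)} {u : ℕ} (K-sub : IsSubgroupSet K)
           (R⊆K : ∀ {x} → x ∈ R → T (K x)) (B≢∅ : 1 ≤ card B) (2B≤K : 2 * card B ≤ card K)
           (∂≤u : ∀ {x} → x ∈ R → ∂ B x ≤ u) where

    private
      module K = IsSubgroupSet K-sub

    level-bound : ∀ d → 3 * d ≤ card B → 2 * card (level K B d) ≤ 3 * card B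
    level-bound d 3d≤B = almost-period-bound B (level K B d) B≢∅ λ g g∈ →
      ≤-trans (*-monoʳ-≤ 3 (proj₂ (level⁻ K B d g g∈))) 3d≤B

    -- Here `2 * card B ≤ card K` enters: it makes a translation-closed level a proper subset of
    -- `K`, as `closed⇒halving` demands.
    level<K : ∀ d → 3 * d ≤ card B → card (level K B d) < card K
    level<K d 3d≤B = *-cancelˡ-< 2 _ _ (begin-strict
      2 * card (level K B d)  ≤⟨ level-bound d 3d≤B ⟩
      3 * card B              <⟨ *-monoˡ-< (card B) {{>-nonZero B≢∅}} (n<1+n 3) ⟩
      4 * card B              ≡⟨ *-assoc 2 2 (card B) ⟩
      2 * (2 * card B)        ≤⟨ *-monoʳ-≤ 2 2B≤K ⟩
      2 * card K              ∎)
      where open ≤-Reasoning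

    Escape : FinSet → Set
    Escape N = ∃ λ g → ∃ λ x → x ∈ R × T (N g) × ¬ T (N (g ∙ x))

    escape? : ∀ N → Escape N ⊎ (∀ {g x} → T (N g) → x ∈ R → T (N (g ∙ x)))
    escape? N with any? (λ g → Any.any? (λ x → T? (N g ∧ not (N (g ∙ x)))) R)
    ... | yes (g , found) = let x , x∈R , esc = find found ; g∈ , gx∉ = ∧⁻ {N g} esc in
                            inj₁ (g , x , x∈R , g∈ , T-not gx∉)
    ... | no  none  = inj₂ λ {g} {x} g∈N x∈R → decidable-stable (T? (N (g ∙ x)))
      λ gx∉N → none (g , lose x∈R (∧⁺ g∈N (¬T⇒T-not gx∉N)))

    -- A point w with d + u < ∂ w ≤ d + 2u translates R into the shell d < ∂ ≤ d + 3u.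
    level-growth : ∀ d → Escape (level K B (u + d)) →
                   card (support R) + card (level K B d) ≤ card (level K B (u + (u + (u + d))))
    level-growth d (g , x , x∈R , g∈ , w∉) = begin
      card (support R) + card (level K B d)
        ≡⟨ cong (_+ card (level K B d)) (sym (sum-translateˡ (𝟙 ∘ support R) (w ⁻¹))) ⟩
      sum (λ h → 𝟙 (support R ((w ⁻¹) ∙ h))) + card (level K B d)
        ≡⟨ sym (∑-distrib-+ {q} _ _) ⟩
      sum (λ h → 𝟙 (support R ((w ⁻¹) ∙ h)) + 𝟙 (level K B d h))
        ≤⟨ sum-mono (λ h → 𝟙-disjoint _ _ _ (inside h) (wider h) (disjoint h)) ⟩
      card (level K B (u + (u + (u + d)))) ∎
      where
      open ≤-Reasoning
      w = g ∙ x
      w∈K : T (K w)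
      w∈K = K.∙-mem (proj₁ (level⁻ K B (u + d) g g∈)) (R⊆K x∈R)
      ∂w≤ : ∂ B w ≤ u + (u + d)
      ∂w≤ = begin
        ∂ B w             ≤⟨ ∂-triangle B g x ⟩
        ∂ B g + ∂ B x     ≤⟨ +-mono-≤ (proj₂ (level⁻ K B (u + d) g g∈)) (∂≤u x∈R) ⟩
        u + d + u         ≡⟨ +-comm (u + d) u ⟩
        u + (u + d)       ∎
      w∙[w⁻¹∙h]≡h : ∀ h → w ∙ ((w ⁻¹) ∙ h) ≡ h
      w∙[w⁻¹∙h]≡h h = trans (sym (assoc w (w ⁻¹) h)) (trans (cong (_∙ h) (inverseʳ w)) (identityˡ h))
      inside : ∀ h → T (support R ((w ⁻¹) ∙ h)) → T (level K B (u + (u + (u + d))) h)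
      inside h y∈ = subst (T ∘ level K B _) (w∙[w⁻¹∙h]≡h h)
        (level⁺ {K} {B} (K.∙-mem w∈K (R⊆K y∈R)) (begin
          ∂ B (w ∙ y)            ≤⟨ ∂-triangle B w y ⟩
          ∂ B w + ∂ B y          ≤⟨ +-mono-≤ ∂w≤ (∂≤u y∈R) ⟩
          u + (u + d) + u        ≡⟨ +-comm (u + (u + d)) u ⟩
          u + (u + (u + d))      ∎))
        where
        y = (w ⁻¹) ∙ h
        y∈R = support⁻ R y∈
      wider : ∀ h → T (level K B d h) → T (level K B (u + (u + (u + d))) h)
      wider h h∈ = let h∈K , ∂h≤d = level⁻ K B d h h∈ in
        level⁺ {K} {B} h∈K (m≤n⇒m≤o+n u (m≤n⇒m≤o+n u (m≤n⇒m≤o+n u ∂h≤d)))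
      disjoint : ∀ h → T (support R ((w ⁻¹) ∙ h)) → T (level K B d h) → ⊥
      disjoint h y∈ h∈ = w∉ (level⁺ {K} {B} w∈K (begin
        ∂ B w                  ≡⟨ cong (∂ B) (sym (x∙y∙y⁻¹≡x w y)) ⟩
        ∂ B ((w ∙ y) ∙ (y ⁻¹)) ≡⟨ cong (λ z → ∂ B (z ∙ (y ⁻¹))) (w∙[w⁻¹∙h]≡h h) ⟩
        ∂ B (h ∙ (y ⁻¹))       ≤⟨ ∂-triangle B h (y ⁻¹) ⟩
        ∂ B h + ∂ B (y ⁻¹)     ≡⟨ cong (∂ B h +_) (∂-inv B y) ⟩
        ∂ B h + ∂ B y          ≤⟨ +-mono-≤ (proj₂ (level⁻ K B d h h∈)) (∂≤u (support⁻ R y∈)) ⟩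
        d + u                  ≡⟨ +-comm d u ⟩
        u + d                  ∎))
        where y = (w ⁻¹) ∙ h

    -- Induction on `r`. With `d` the current radius, either the level `u + d` is closed under
    -- translation by `R`, giving a halving, or an escaping point adds `card (support R)` elements
    -- at the cost of `3 * u` in radius.
    spread : ∀ r → 3 * ((2 + r * 3) * u) ≤ card B →
             Halving K R ⊎ suc r * card (support R) ≤ card (level K B ((2 + r * 3) * u))
    spread zero _ = inj₂ (≤-trans (≤-reflexive (+-identityʳ _)) (card-mono {support R} λ x x∈ →
      level⁺ {K} {B} (R⊆K (support⁻ R x∈)) (≤-trans (∂≤u (support⁻ R x∈)) (m≤m+n u _))))
    spread (suc r) bound
      with spread r (≤-trans (*-monoʳ-≤ 3 (m≤n⇒m≤o+n u (m≤n⇒m≤o+n u (m≤n+m _ u)))) bound)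
         | escape? (level K B (u + (2 + r * 3) * u))
    ... | inj₁ halving | _            = inj₁ halving
    ... | inj₂ _       | inj₂ closed  = inj₁ (closed⇒halving K-sub R⊆K
            (level⁺ {K} {B} K.ε-mem (≤-trans (≤-reflexive (∂-ε B)) z≤n)) closed
            (level<K _ (≤-trans (*-monoʳ-≤ 3 (m≤n⇒m≤o+n u (m≤n+m _ u))) bound)))
    ... | inj₂ ih      | inj₁ escapes = inj₂ (≤-trans (+-monoʳ-≤ (card (support R)) ih)
            (level-growth ((2 + r * 3) * u) escapes))

    -- The growth alternative of `spread` would make the last level larger than `level-bound`
    -- allows.
    small-∂⇒halving : ∀ r → 9 * suc r * u ≤ card B → 3 * card B < 2 * (suc r * card (support R)) → Halving K R
    small-∂⇒halving r 9[1+r]u≤B 3B<2[1+r]s = [ id , (λ rs≤N →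
      contradiction 3B<2[1+r]s (≤⇒≯ (≤-trans (*-monoʳ-≤ 2 rs≤N) (level-bound _ 3d≤B)))) ]′ (spread r 3d≤B)
      where
      open ≤-Reasoning
      3d≤B : 3 * ((2 + r * 3) * u) ≤ card B
      3d≤B = begin
        3 * ((2 + r * 3) * u)  ≤⟨ *-monoʳ-≤ 3 (*-monoˡ-≤ u (n≤1+n (2 + r * 3))) ⟩
        3 * (suc r * 3 * u)    ≡⟨ sym (*-assoc 3 (suc r * 3) u) ⟩
        3 * (suc r * 3) * u    ≡⟨ cong (λ z → 3 * z * u) (*-comm (suc r) 3) ⟩
        3 * (3 * suc r) * u    ≡⟨ cong (_* u) (sym (*-assoc 3 3 (suc r))) ⟩
        9 * suc r * u          ≤⟨ 9[1+r]u≤B ⟩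
        card B                 ∎

  -- Multiplicities, energy and subsequences.

  mult : List (Fin q) → Fin q → ℕ
  mult []      k = 0
  mult (x ∷ L) k = 𝟙 (does (x ≟ k)) + mult L k

  energy : List (Fin q) → ℕ
  energy L = sum λ k → mult L k * mult L k

  sum-mult : ∀ L → sum (mult L) ≡ length L
  sum-mult []      = sum-zero {q} λ _ → refl
  sum-mult (x ∷ L) = trans (∑-distrib-+ {q} (λ k → 𝟙 (does (x ≟ k))) (mult L))
                           (cong₂ _+_ (sum-point x) (sum-mult L))

  m≤m*m : ∀ m → m ≤ m * m
  m≤m*m zero    = z≤n
  m≤m*m (suc m) = m≤m+n (suc m) _

  -- Multiplicities are integers, so each is at most its square. With the energy hypothesis this
  -- yields a quadratic lower bound on the length in terms of the group order.
  length≤energy : ∀ L → length L ≤ energy L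
  length≤energy L = ≤-trans (≤-reflexive (sym (sum-mult L))) (sum-mono λ k → m≤m*m (mult L k))

  mult-++ : ∀ I R k → mult (I ++ R) k ≡ mult I k + mult R k
  mult-++ []      R k = refl
  mult-++ (x ∷ I) R k = trans (cong (𝟙 (does (x ≟ k)) +_) (mult-++ I R k)) (sym (+-assoc (𝟙 (does (x ≟ k))) _ _))

  mult-↭ : ∀ {L M} → L ↭ M → ∀ k → mult L k ≡ mult M k
  mult-↭ Perm.refl        k = refl
  mult-↭ (prep x r)  k = cong (𝟙 (does (x ≟ k)) +_) (mult-↭ r k)
  mult-↭ (swap x y r) k = trans (cong (λ m → 𝟙 (does (x ≟ k)) + (𝟙 (does (y ≟ k)) + m)) (mult-↭ r k))
    (x∙yz≈y∙xz (𝟙 (does (x ≟ k))) (𝟙 (does (y ≟ k))) _)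
  mult-↭ (Perm.trans r s) k = trans (mult-↭ r k) (mult-↭ s k)

  mult-support : ∀ R k → ¬ k ∈ R → mult R k ≡ 0
  mult-support []      k _   = refl
  mult-support (x ∷ R) k k∉ with x ≟ k
  ... | yes refl = contradiction (here refl) k∉
  ... | no  _    = mult-support R k (k∉ ∘ there)

  infix 4 _⊑_
  -- Inclusion of multisets, witnessed by the complement `I`; the order of terms is immaterial to
  -- their sums.
  _⊑_ : List (Fin q) → List (Fin q) → Set
  R ⊑ L = ∃ λ I → L ↭ I ++ R

  ⊑-refl : ∀ {L} → L ⊑ L
  ⊑-refl = [] , ↭-refl

  ⊑-trans : ∀ {P R L} → P ⊑ R → R ⊑ L → P ⊑ L
  ⊑-trans {P} (I , R↭) (J , L↭) = J ++ I , ↭-trans L↭ (↭-trans (++⁺ˡ J R↭) (↭-reflexive (sym (++-assoc J I P))))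

  ∈-⊑ : ∀ {R L x} → R ⊑ L → x ∈ R → x ∈ L
  ∈-⊑ (I , L↭) x∈R = ∈-resp-↭ (↭-sym L↭) (∈-++⁺ʳ I x∈R)

  energy-mono : ∀ {R L} → R ⊑ L → energy R ≤ energy L
  energy-mono {R} {L} (I , L↭) = sum-mono λ k → *-mono-≤ (mult-mono k) (mult-mono k)
    where
    mult-mono : ∀ k → mult R k ≤ mult L k
    mult-mono k = ≤-trans (m≤n+m (mult R k) (mult I k))
      (≤-reflexive (sym (trans (mult-↭ L↭ k) (mult-++ I R k))))

  card-support>0 : ∀ R → 1 ≤ length R → 1 ≤ card (support R)
  card-support>0 (x ∷ R) _ = ≤-trans (𝟙-mono true (support (x ∷ R) x) λ _ → fromWitness {a? = x ∈? (x ∷ R)} (here refl))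
    (sum-term (𝟙 ∘ support (x ∷ R)) x)

  -- The weighted AM-GM inequality 2 t v m ≤ v² m² + t² summed over the support, at t = |R| and v = |support R|.
  cauchy-schwarz : ∀ R → 1 ≤ length R → length R * length R ≤ card (support R) * energy R
  cauchy-schwarz R R≢[] = *-cancelˡ-≤ v {{>-nonZero (card-support>0 R R≢[])}} (+-cancelʳ-≤ (v * (t * t)) _ _ (begin
    v * (t * t) + v * (t * t)                          ≡⟨ lemma₁ v t ⟩
    2 * t * v * t                                      ≡⟨ cong (2 * t * v *_) (sym (sum-mult R)) ⟩
    2 * t * v * sum (mult R)                           ≡⟨ *-distribˡ-sum (2 * t * v) (mult R) ⟩
    sum (λ k → 2 * t * v * mult R k)                   ≤⟨ sum-mono pointwise ⟩
    sum (λ k → v * v * (mult R k * mult R k) + t * t * 𝟙 (support R k))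
                                                       ≡⟨ ∑-distrib-+ {q} _ _ ⟩
    sum (λ k → v * v * (mult R k * mult R k)) + sum (λ k → t * t * 𝟙 (support R k))
      ≡⟨ sym (cong₂ _+_ (*-distribˡ-sum (v * v) (λ k → mult R k * mult R k)) (*-distribˡ-sum (t * t) (𝟙 ∘ support R))) ⟩
    v * v * energy R + t * t * v                       ≡⟨ cong₂ _+_ (*-assoc v v (energy R)) (*-comm (t * t) v) ⟩
    v * (v * energy R) + v * (t * t)                   ∎))
    where
    open ≤-Reasoning
    t = length R
    v = card (support R)
    lemma₁ : ∀ v t → v * (t * t) + v * (t * t) ≡ 2 * t * v * t
    lemma₁ = solve-∀
    lemma₂ : ∀ t v m → 2 * t * v * m ≡ 2 * (v * m) * t
    lemma₂ = solve-∀
    lemma₃ : ∀ t v m → (v * m) * (v * m) + t * t ≡ v * v * (m * m) + t * t * 1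
    lemma₃ = solve-∀
    pointwise : ∀ k → 2 * t * v * mult R k ≤ v * v * (mult R k * mult R k) + t * t * 𝟙 (support R k)
    pointwise k with k ∈? R
    ... | no k∉R rewrite mult-support R k k∉R | *-zeroʳ (2 * t * v) = z≤n
    ... | yes _ = begin
      2 * t * v * mult R k              ≡⟨ lemma₂ t v (mult R k) ⟩
      2 * (v * mult R k) * t            ≤⟨ 2xy≤x²+y² (v * mult R k) t ⟩
      (v * mult R k) * (v * mult R k) + t * t   ≡⟨ lemma₃ t v (mult R k) ⟩
      v * v * (mult R k * mult R k) + t * t * 1 ∎

  -- Subset sums of a sequence.

  subsetSums : List (Fin q) → FinSet
  -- The empty selection is allowed here; nonemptiness is restored later by a spare term.
  subsetSums []      g = does (ε ≟ g)
  subsetSums (x ∷ I) g = subsetSums I g ∨ subsetSums I (g ∙ (x ⁻¹))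

  -- The new sums are the elements of the translate of `B` by `x` outside `B`; translating them back
  -- gives exactly the points counted by `∂ B x`.
  card-subsetSums-∷ : ∀ x I → card (subsetSums (x ∷ I)) ≡ card (subsetSums I) + ∂ (subsetSums I) x
  card-subsetSums-∷ x I = begin
    card (subsetSums (x ∷ I))                            ≡⟨ sum-cong-≗ (λ g → ∨-split (B g) (B (g ∙ (x ⁻¹)))) ⟩
    sum (λ g → 𝟙 (B g) + 𝟙 (B (g ∙ (x ⁻¹)) ∧ not (B g)))  ≡⟨ ∑-distrib-+ {q} _ _ ⟩
    card B + sum (λ g → 𝟙 (B (g ∙ (x ⁻¹)) ∧ not (B g)))
      ≡⟨ cong (card B +_) (sym (sum-translate (λ g → 𝟙 (B (g ∙ (x ⁻¹)) ∧ not (B g))) x)) ⟩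
    card B + sum (λ g → 𝟙 (B ((g ∙ x) ∙ (x ⁻¹)) ∧ not (B (g ∙ x))))
      ≡⟨ cong (card B +_) (sum-cong-≗ λ g → cong (λ y → 𝟙 (B y ∧ not (B (g ∙ x)))) (x∙y∙y⁻¹≡x g x)) ⟩
    card B + ∂ B x                                       ∎
    where
    open ≡-Reasoning
    B = subsetSums I

  card-subsetSums>0 : ∀ I → 1 ≤ card (subsetSums I)
  card-subsetSums>0 []      = ≤-reflexive (sym (sum-point ε))
  card-subsetSums>0 (x ∷ I) = ≤-trans (card-subsetSums>0 I)
    (≤-trans (m≤m+n _ _) (≤-reflexive (sym (card-subsetSums-∷ x I))))

  total : List (Fin q) → Fin q
  total = foldr _∙_ ε

  total-++ : ∀ xs ys → total (xs ++ ys) ≡ total xs ∙ total ys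
  total-++ []       ys = sym (identityˡ _)
  total-++ (x ∷ xs) ys = trans (cong (x ∙_) (total-++ xs ys)) (sym (assoc x _ _))

  total-↭ : ∀ {L M} → L ↭ M → total L ≡ total M
  total-↭ Perm.refl        = refl
  total-↭ (prep x r)       = cong (x ∙_) (total-↭ r)
  total-↭ (swap {xs} x y r) = trans (sym (assoc x y (total xs)))
    (trans (cong₂ _∙_ (comm x y) (total-↭ r)) (assoc y x _))
  total-↭ (Perm.trans r s) = trans (total-↭ r) (total-↭ s)

  subsetSums⁻ : ∀ I {g} → T (subsetSums I g) → ∃ λ xs → ∃ λ ys → I ↭ xs ++ ys × total xs ≡ g
  subsetSums⁻ [] {g} g∈ with ε ≟ g
  ... | yes ε≡g = [] , [] , ↭-refl , ε≡g
  subsetSums⁻ (x ∷ I) {g} g∈ with Equivalence.to (T-∨ {subsetSums I g}) g∈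
  ... | inj₁ g∈I with subsetSums⁻ I g∈I
  ...   | xs , ys , I↭ , sum≡ = xs , x ∷ ys , ↭-trans (prep x I↭) (↭-sym (shift x xs ys)) , sum≡
  subsetSums⁻ (x ∷ I) {g} g∈ | inj₂ gx∈I with subsetSums⁻ I gx∈I
  ...   | xs , ys , I↭ , sum≡ = x ∷ xs , ys , prep x I↭ ,
            trans (cong (x ∙_) sum≡) (trans (comm x _) (x∙y⁻¹∙y≡x g x))

  subsetSums⊆ : ∀ {K} → IsSubgroupSet K → ∀ I → (∀ {x} → x ∈ I → T (K x)) → ∀ g → T (subsetSums I g) → T (K g)
  subsetSums⊆ {K} K-sub [] I⊆K g g∈ with ε ≟ g
  ... | yes ε≡g = subst (T ∘ K) ε≡g (IsSubgroupSet.ε-mem K-sub)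
  subsetSums⊆ {K} K-sub (x ∷ I) I⊆K g g∈ with Equivalence.to (T-∨ {subsetSums I g}) g∈
  ... | inj₁ g∈I  = subsetSums⊆ K-sub I (I⊆K ∘ there) g g∈I
  ... | inj₂ gx∈I = subst (T ∘ K) (x∙y⁻¹∙y≡x g x)
        (IsSubgroupSet.∙-mem K-sub (subsetSums⊆ K-sub I (I⊆K ∘ there) _ gx∈I) (I⊆K (here refl)))

  length-filter-mult : ∀ {n} {A : Set} (b : A → Fin q) (f : Fin n → A) k →
    length (filter (λ i → b i ≟ k) (tabulate f)) ≡ mult (tabulate (b ∘ f)) k
  length-filter-mult {zero}  b f k = refl
  length-filter-mult {suc n} b f k with does (b (f zero) ≟ k)
  ... | true  = cong suc (length-filter-mult b (f ∘ suc) k)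
  ... | false = length-filter-mult b (f ∘ suc) k

  extract : ∀ R B u → (∃ λ x → ∃ λ R′ → R ↭ x ∷ R′ × u < ∂ B x) ⊎ (∀ {x} → x ∈ R → ∂ B x ≤ u)
  extract R B u with Any.any? (λ x → u <? ∂ B x) R
  ... | no none = inj₂ λ x∈R → ≮⇒≥ λ u<∂ → none (lose x∈R u<∂)
  ... | yes found with find found
  ...   | x , x∈R , u<∂ with ∈-∃++ x∈R
  ...     | ys , zs , refl = inj₁ (x , ys ++ zs , shift x ys zs , u<∂)

  -- Zero-sum subsequences from two large sets of sums.

  ZeroSum : List (Fin q) → Set
  -- The shape `x ∷ xs` of the selected part encodes nonemptiness.
  ZeroSum L = ∃ λ x → ∃ λ xs → ∃ λ ys → L ↭ (x ∷ xs) ++ ys × total (x ∷ xs) ≡ ε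

  ZeroSum-⊑ : ∀ {R L} → R ⊑ L → ZeroSum R → ZeroSum L
  ZeroSum-⊑ {R} {L} (I , L↭) (x , xs , ys , R↭ , sum≡ε) = x , xs , ys ++ I ,
    ↭-trans L↭ (↭-trans (++-comm I R) (↭-trans (++⁺ʳ I R↭) (↭-reflexive (++-assoc (x ∷ xs) ys I)))) , sum≡ε

  -- `A` and the reflection of `B` through `c` both lie in `K` and each fill more than half of it,
  -- so they meet.
  complementary : ∀ {K A B} → IsSubgroupSet K → (∀ g → T (A g) → T (K g)) → (∀ g → T (B g) → T (K g)) →
                  card K < 2 * card A → card K < 2 * card B → ∀ c → T (K c) → ∃ λ g → T (A g) × T (B (c ∙ (g ⁻¹)))
  complementary {K} {A} {B} K-sub A⊆K B⊆K K<2A K<2B c c∈K with sum<⇒∃< {f = 𝟙 ∘ K} {g = λ g → 𝟙 (A g) + 𝟙 (B (c ∙ (g ⁻¹)))} K<A+B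
    where
    open ≤-Reasoning
    double : ∀ k → 2 * k ≡ k + k
    double = solve-∀
    K<A+B : card K < sum λ g → 𝟙 (A g) + 𝟙 (B (c ∙ (g ⁻¹)))
    K<A+B = *-cancelˡ-< 2 _ _ (begin-strict
      2 * card K                                       ≡⟨ double (card K) ⟩
      card K + card K                                  <⟨ +-mono-< K<2A K<2B ⟩
      2 * card A + 2 * card B                          ≡⟨ sym (*-distribˡ-+ 2 (card A) (card B)) ⟩
      2 * (card A + card B)                            ≡⟨ cong (λ z → 2 * (card A + z)) (sym (sum-reflect (𝟙 ∘ B) c)) ⟩
      2 * (card A + sum (λ g → 𝟙 (B (c ∙ (g ⁻¹)))))    ≡⟨ cong (2 *_) (sym (∑-distrib-+ {q} _ _)) ⟩
      2 * sum (λ g → 𝟙 (A g) + 𝟙 (B (c ∙ (g ⁻¹))))     ∎)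
  ... | g , K<A+B with T? (A g) | T? (B (c ∙ (g ⁻¹)))
  ...   | yes g∈A | yes cg∈B = g , g∈A , cg∈B
  ...   | no  g∉A | _        = contradiction K<A+B (≤⇒≯ (𝟙-disjoint (A g) _ _ (A⊆K g) in-K λ g∈A _ → g∉A g∈A))
    where
    in-K : T (B (c ∙ (g ⁻¹))) → T (K g)
    in-K cg∈B = subst (T ∘ K) (reflect-involutive c g)
      (IsSubgroupSet.∙-mem K-sub c∈K (IsSubgroupSet.⁻¹-mem K-sub (B⊆K _ cg∈B)))
  ...   | yes _   | no cg∉B  = contradiction K<A+B (≤⇒≯ (𝟙-disjoint (A g) _ _ (A⊆K g) (λ p → contradiction p cg∉B) λ _ → cg∉B))

  -- Write `x ⁻¹` as a sum from `I` plus a sum from `J` and adjoin `x`. Even if both selections are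
  -- empty, `x` keeps the result nonempty.
  two-halves⇒ZeroSum : ∀ {K I J x R} → IsSubgroupSet K → (∀ {y} → y ∈ I ++ (J ++ x ∷ R) → T (K y)) →
                       card K < 2 * card (subsetSums I) → card K < 2 * card (subsetSums J) → ZeroSum (I ++ (J ++ x ∷ R))
  two-halves⇒ZeroSum {K} {I} {J} {x} {R} K-sub L⊆K K<2I K<2J
    with complementary K-sub (subsetSums⊆ K-sub I (L⊆K ∘ ∈-++⁺ˡ))
                             (subsetSums⊆ K-sub J (L⊆K ∘ ∈-++⁺ʳ I ∘ ∈-++⁺ˡ)) K<2I K<2J (x ⁻¹)
                             (IsSubgroupSet.⁻¹-mem K-sub (L⊆K (∈-++⁺ʳ I (∈-++⁺ʳ J (here refl)))))
  ... | g , g∈I , xg∈J with subsetSums⁻ I g∈I | subsetSums⁻ J xg∈J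
  ...   | xs , xs′ , I↭ , Σxs | ys , ys′ , J↭ , Σys =
    x , xs ++ ys , xs′ ++ (ys′ ++ R) ,
    ↭-trans (++⁺ I↭ (++⁺ʳ (x ∷ R) J↭)) (rearrange [ x ] R xs xs′ ys ys′) ,
    (begin
      x ∙ total (xs ++ ys)            ≡⟨ cong (x ∙_) (total-++ xs ys) ⟩
      x ∙ (total xs ∙ total ys)       ≡⟨ cong (x ∙_) (cong₂ _∙_ Σxs Σys) ⟩
      x ∙ (g ∙ ((x ⁻¹) ∙ (g ⁻¹)))     ≡⟨ cong (x ∙_) (trans (comm g _) (x∙y⁻¹∙y≡x (x ⁻¹) g)) ⟩
      x ∙ (x ⁻¹)                      ≡⟨ inverseʳ x ⟩
      ε                               ∎)
    where
    open ≡-Reasoning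
    open CommutativeMonoidSolver (++-commutativeMonoid {A = Fin q})
    rearrange : ∀ X R A A′ B B′ → (A ++ A′) ++ ((B ++ B′) ++ (X ++ R)) ↭ (X ++ (A ++ B)) ++ (A′ ++ (B′ ++ R))
    rearrange = solve 6 (λ X R A A′ B B′ → (A ⊕ A′) ⊕ ((B ⊕ B′) ⊕ (X ⊕ R)) ⊜ (X ⊕ (A ⊕ B)) ⊕ (A′ ⊕ (B′ ⊕ R))) ↭-refl

  -- Greedy growth and descent to subgroups.

  module _ {K : FinSet} {L : List (Fin q)} {u c : ℕ} (K-sub : IsSubgroupSet K) (L⊆K : ∀ {x} → x ∈ L → T (K x))
           (rich : ∀ {R} → R ⊑ L → c ≤ length R → 27 * u < card (support R)) where

    Descent : Set
    Descent = ∃ λ R → R ⊑ L × c ≤ length R × Halving K R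

    -- Each step moves to `I` a term of `R` with displacement above `v`. If there is none, `R` falls
    -- under `small-∂⇒halving`; the reserve of `c` terms keeps `rich` applicable, and
    -- `9 * v ≤ card (subsetSums I)` feeds `choose-radius`.
    grow : ∀ v → v ≤ u → ∀ p I R → I ++ R ⊑ L → p + c ≤ length R → 9 * v ≤ card (subsetSums I) →
           Descent ⊎ ∃ λ I′ → ∃ λ R′ → I ++ R ↭ I′ ++ R′ × length R ≤ p + length R′ ×
             (card (subsetSums I) + p * suc v ≤ card (subsetSums I′) ⊎ card K < 2 * card (subsetSums I′))
    grow v v≤u zero    I R _ _ _ = inj₂ (I , R , ↭-refl , ≤-refl , inj₁ (≤-reflexive (+-identityʳ _)))
    grow v v≤u (suc p) I R IR⊑L p+c≤R 9v≤B
      -- Growth stops once half of `K` is passed; below that, the set of sums is small enough for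
      -- the halving argument.
      with card K <? 2 * card (subsetSums I) | extract R (subsetSums I) v
    ... | yes K<2B | _ = inj₂ (I , R , ↭-refl , m≤n+m _ (suc p) , inj₂ K<2B)
    ... | no  K≮2B | inj₂ ∂≤v =
      let R⊑L = ⊑-trans (I , ↭-refl) IR⊑L
          c≤R = m+n≤o⇒n≤o (suc p) p+c≤R
          r , radius , wide = choose-radius {u = v} (card-subsetSums>0 I) 9v≤B
                                (≤-<-trans (*-monoʳ-≤ 27 v≤u) (rich R⊑L c≤R))
      in inj₁ (R , R⊑L , c≤R , small-∂⇒halving {u = v} K-sub (L⊆K ∘ ∈-⊑ R⊑L) (card-subsetSums>0 I) (≮⇒≥ K≮2B) ∂≤v r radius wide)
    ... | no _ | inj₁ (x , R′ , R↭ , v<∂)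
      with IR↭ ← ↭-trans (++⁺ˡ I R↭) (shift x I R′)
      with grow v v≤u p (x ∷ I) R′ (⊑-trans ([] , IR↭) IR⊑L)
             (s≤s⁻¹ (≤-trans p+c≤R (≤-reflexive (↭-length R↭))))
             (≤-trans 9v≤B (≤-trans (m≤m+n _ _) (≤-reflexive (sym (card-subsetSums-∷ x I)))))
    ...   | inj₁ descent = inj₁ descent
    ...   | inj₂ (I″ , R″ , IR′↭ , R′≤ , size) =
      inj₂ (I″ , R″ , ↭-trans IR↭ IR′↭ , ≤-trans (≤-reflexive (↭-length R↭)) (s≤s R′≤) , [ inj₁ ∘ enlarge , inj₂ ]′ size)
      where
      enlarge : card (subsetSums (x ∷ I)) + p * suc v ≤ card (subsetSums I″) →
                card (subsetSums I) + suc p * suc v ≤ card (subsetSums I″)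
      enlarge le = begin
        card (subsetSums I) + (suc v + p * suc v)   ≡⟨ sym (+-assoc (card (subsetSums I)) (suc v) _) ⟩
        card (subsetSums I) + suc v + p * suc v     ≤⟨ +-monoˡ-≤ (p * suc v) (+-monoʳ-≤ (card (subsetSums I)) v<∂) ⟩
        card (subsetSums I) + ∂ (subsetSums I) x + p * suc v ≡⟨ cong (_+ p * suc v) (sym (card-subsetSums-∷ x I)) ⟩
        card (subsetSums (x ∷ I)) + p * suc v       ≤⟨ le ⟩
        card (subsetSums I″)                        ∎
        where open ≤-Reasoning

    -- Growing by one per step until |B| ≥ 9u makes the faster growth by u + 1 available.
    half : ∀ p R → R ⊑ L → p + (p + c) ≤ length R → 9 * u ≤ p → card K < 2 * (p * suc u) →
           Descent ⊎ ∃ λ I → ∃ λ R′ → R ↭ I ++ R′ × length R ≤ p + (p + length R′) × card K < 2 * card (subsetSums I)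
    half p R R⊑L 2p+c≤R 9u≤p K<2pu with grow 0 z≤n p [] R R⊑L (≤-trans (+-monoʳ-≤ p (m≤n+m c p)) 2p+c≤R) z≤n
    ... | inj₁ descent = inj₁ descent
    ... | inj₂ (I , R₁ , R↭ , R≤ , inj₂ K<2B) = inj₂ (I , R₁ , R↭ , ≤-trans R≤ (+-monoʳ-≤ p (m≤n+m _ p)) , K<2B)
    ... | inj₂ (I , R₁ , R↭ , R≤ , inj₁ p≤B)
      with grow u ≤-refl p I R₁ (⊑-trans ([] , R↭) R⊑L) (+-cancelˡ-≤ p _ _ (≤-trans 2p+c≤R R≤))
             (≤-trans 9u≤p (≤-trans (m≤n+m p _) (≤-trans (+-monoʳ-≤ (card (subsetSums [])) (≤-reflexive (sym (*-identityʳ p)))) p≤B)))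
    ...   | inj₁ descent = inj₁ descent
    ...   | inj₂ (J , R₂ , IR₁↭ , R₁≤ , size) = inj₂ (J , R₂ , ↭-trans R↭ IR₁↭ ,
              ≤-trans R≤ (+-monoʳ-≤ p R₁≤) ,
              [ (λ pu≤B → <-≤-trans K<2pu (*-monoʳ-≤ 2 (≤-trans (m≤n+m (p * suc u) (card (subsetSums I))) pu≤B))) , id ]′ size)

    -- Each call of `half` consumes at most `2 * p` terms, so after two of them at least `c`, hence
    -- one, remains to serve as the spare term.
    descent-or-ZeroSum : ∀ p → 1 ≤ c → p + (p + (p + (p + c))) ≤ length L → 9 * u ≤ p → card K < 2 * (p * suc u) →
                         Descent ⊎ ZeroSum L
    descent-or-ZeroSum p 1≤c 4p+c≤L 9u≤p K<2pu
      with half p L ⊑-refl (≤-trans (+-monoʳ-≤ p (+-monoʳ-≤ p (≤-trans (m≤n+m _ p) (m≤n+m _ p)))) 4p+c≤L) 9u≤p K<2pu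
    ... | inj₁ descent = inj₁ descent
    ... | inj₂ (I , R₁ , L↭ , L≤ , K<2I)
      with 2p+c≤R₁ ← +-cancelˡ-≤ p _ _ (+-cancelˡ-≤ p _ _ (≤-trans 4p+c≤L L≤))
      with half p R₁ (I , L↭) 2p+c≤R₁ 9u≤p K<2pu
    ...   | inj₁ descent = inj₁ descent
    ...   | inj₂ (J , R₂ , R₁↭ , R₁≤ , K<2J)
      with R₂ | +-cancelˡ-≤ p _ _ (+-cancelˡ-≤ p _ _ (≤-trans 2p+c≤R₁ R₁≤))
    ...     | []     | c≤0 = contradiction (≤-trans 1≤c c≤0) λ ()
    ...     | x ∷ R  | _   = inj₂ (ZeroSum-⊑ ([] , L↭′)
                (two-halves⇒ZeroSum {I = I} {J} K-sub (L⊆K ∘ ∈-⊑ ([] , L↭′)) K<2I K<2J))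
      where
      L↭′ : L ↭ I ++ (J ++ x ∷ R)
      L↭′ = ↭-trans L↭ (++⁺ˡ I R₁↭)

  -- Well-founded induction on the order of `K`: a descent passes to a smaller subgroup and a
  -- subsequence that still satisfies the hypothesis.
  sparse⇒ZeroSum : ∀ {K} → Acc _<_ (card K) → IsSubgroupSet K → ∀ L → (∀ {x} → x ∈ L → T (K x)) →
                   100000 * card K * energy L < length L * length L * length L → ZeroSum L
  sparse⇒ZeroSum {K} (acc smaller) K-sub L L⊆K sparse = [ descend , id ]′
    (descent-or-ZeroSum {u = u} K-sub L⊆K rich p (1≤l ≤-refl) 4p+c≤n 9u≤p k<2p[1+u])
    where
    open Parameters (card-subgroup>0 K-sub) (length≤energy L) sparse
    rich : ∀ {R} → R ⊑ L → c ≤ length R → 27 * u < card (support R)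
    rich {R} R⊑L c≤R = 27u<s c≤R
      (≤-trans (cauchy-schwarz R (1≤l c≤R)) (*-monoʳ-≤ (card (support R)) (energy-mono R⊑L)))
    descend : Descent {u = u} K-sub L⊆K rich → ZeroSum L
    descend (R , R⊑L , c≤R , halving) = ZeroSum-⊑ R⊑L
      (sparse⇒ZeroSum (smaller K′<K) isSubgroupSet R members
        (hypothesis-inherited c≤R {card subgroup} halved (energy-mono R⊑L)))
      where
      open Halving halving
      K′<K : card subgroup < card K
      -- A subgroup is nonempty, so `1 + card subgroup` is at most `2 * card subgroup`.
      K′<K = ≤-trans (+-mono-≤ (card-subgroup>0 isSubgroupSet) (m≤m+n (card subgroup) 0)) halved

-- The quotient group on coset labels.

module Quotient {c ℓ h : Level} (G : AbelianGroup c ℓ) {H : AbelianGroup.Carrier G → Set h} (H-sub : IsSubgroup G H)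
  {q : ℕ} {π : AbelianGroup.Carrier G → Fin q} (labelling : IsQuotientLabelling G H q π) where

  module G = AbelianGroup G
  open AbelianGroupProperties G using (⁻¹-∙-comm)
  open CommutativeSemigroupProperties G.commutativeSemigroup using (interchange)
  open IsSubgroup H-sub
  open IsQuotientLabelling labelling

  σ : Fin q → G.Carrier
  σ k = proj₁ (surjective k)

  πσ : ∀ k → π (σ k) ≡ k
  πσ k = proj₂ (surjective k)

  π-cong : ∀ {x y} → x G.≈ y → π x ≡ π y
  π-cong {x} {y} x≈y = Equivalence.from (same-coset x y)
    (respects (G.trans (G.sym (G.inverseʳ y)) (G.∙-congʳ (G.sym x≈y))) ε∈H)

  -- By commutativity the quotient of the two products is the product of the two quotients, each in
  -- `H`.
  π-∙-cong : ∀ {x x′ y y′} → π x ≡ π x′ → π y ≡ π y′ → π (x G.∙ y) ≡ π (x′ G.∙ y′)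
  π-∙-cong {x} {x′} {y} {y′} πx≡ πy≡ = Equivalence.from (same-coset _ _)
    (respects (G.trans (interchange x (x′ G.⁻¹) y (y′ G.⁻¹)) (G.∙-congˡ (⁻¹-∙-comm x′ y′)))
      (∙-closed (Equivalence.to (same-coset x x′) πx≡) (Equivalence.to (same-coset y y′) πy≡)))

  -- The quotient law on chosen representatives; by `π-∙-cong` the choice does not matter.
  _⊕_ : Op₂ (Fin q)
  k ⊕ l = π (σ k G.∙ σ l)

  ⊖_ : Op₁ (Fin q)
  ⊖ k = π (σ k G.⁻¹)

  ⊕-homo : ∀ x y → π (x G.∙ y) ≡ π x ⊕ π y
  ⊕-homo x y = π-∙-cong (sym (πσ (π x))) (sym (πσ (π y)))

  quotient-isAbelianGroup : IsAbelianGroup _≡_ _⊕_ (π G.ε) ⊖_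
  quotient-isAbelianGroup = record
    { isGroup = record
      { isMonoid = record
        { isSemigroup = record
          { isMagma = record { isEquivalence = isEquivalence ; ∙-cong = cong₂ _⊕_ }
          ; assoc = λ k l m → trans (π-∙-cong (πσ _) refl)
              (trans (π-cong (G.assoc (σ k) (σ l) (σ m))) (π-∙-cong refl (sym (πσ _))))
          }
        ; identity = (λ k → trans (π-∙-cong (πσ _) refl) (trans (π-cong (G.identityˡ (σ k))) (πσ k))) ,
                     (λ k → trans (π-∙-cong refl (πσ _)) (trans (π-cong (G.identityʳ (σ k))) (πσ k)))
        }
      ; inverse = (λ k → trans (π-∙-cong (πσ _) refl) (π-cong (G.inverseˡ (σ k)))) ,
                  (λ k → trans (π-∙-cong refl (πσ _)) (π-cong (G.inverseʳ (σ k))))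
      ; ⁻¹-cong = cong ⊖_
      }
    ; comm = λ k l → π-cong (G.comm (σ k) (σ l))
    }

  open FiniteAbelianGroup quotient-isAbelianGroup

  -- Turns a selection of residues into a set of indices. Residues may repeat, so each index takes
  -- any matching occurrence in `xs` or `ys`; only the total matters. The disjunction carries
  -- nonemptiness through the recursion.
  realise : ∀ {n} (a : Fin n → G.Carrier) xs ys → tabulate (π ∘ a) ↭ xs ++ ys →
            ∃ λ S → (Nonempty S ⊎ xs ≡ []) × π (subsetSum G S a) ≡ total xs
  realise {zero}  a [] ys _ = [] , inj₂ refl , refl
  realise {zero}  a (x ∷ xs) ys []↭ with ↭-empty-inv (↭-sym []↭)
  ... | ()
  realise {suc n} a xs ys a↭ with ∈-++⁻ xs (∈-resp-↭ a↭ (here refl))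
  ... | inj₁ a₀∈xs with ∈-∃++ a₀∈xs
  ...   | us , vs , refl with realise (a ∘ suc) (us ++ vs) ys
                                (drop-∷ (↭-trans a↭ (++⁺ʳ ys (shift (π (a zero)) us vs))))
  ...     | S , _ , eq = true ∷ S , inj₁ (zero , Vec.here) ,
            trans (⊕-homo _ _) (trans (cong (π (a zero) ⊕_) eq) (sym (total-↭ (shift (π (a zero)) us vs))))
  realise {suc n} a xs ys a↭ | inj₂ a₀∈ys with ∈-∃++ a₀∈ys
  ...   | us , vs , refl with realise (a ∘ suc) xs (us ++ vs)
          (drop-∷ (↭-trans a↭ (↭-trans (++⁺ˡ xs (shift (π (a zero)) us vs)) (shift (π (a zero)) xs (us ++ vs)))))
  ...     | S , inj₁ (i , i∈S) , eq = false ∷ S , inj₁ (suc i , Vec.there i∈S) , eq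
  ...     | S , inj₂ xs≡[]     , eq = false ∷ S , inj₂ xs≡[] , eq

  sumSqFibers≡energy : ∀ {n} (a : Fin n → G.Carrier) → sumSqFibers G π a ≡ energy (tabulate (π ∘ a))
  sumSqFibers≡energy {n} a = trans (sum-map-tabulate (λ k → fiberCount G π a k * fiberCount G π a k) id)
    (sum-cong-≗ λ k → cong₂ _*_ (length-filter-mult (π ∘ a) id k) (length-filter-mult (π ∘ a) id k))

-- Application to the whole quotient.

theorem5p3 : ∀ {c ℓ h : Level} (G : AbelianGroup c ℓ)
    (H : AbelianGroup.Carrier G → Set h) → IsSubgroup G H →
    (q : ℕ) (π : AbelianGroup.Carrier G → Fin q) → IsQuotientLabelling G H q π →
    (n : ℕ) (a : Fin n → AbelianGroup.Carrier G) → IsInjectiveFamily G a →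
    65536 * q < n * n →
    100000 * q * sumSqFibers G π a < n * n * n →
    Σ (Subset n) λ S → Nonempty S × (π (subsetSum G S a) ≡ π (AbelianGroup.ε G))
theorem5p3 G H H-sub q π labelling n a _ _ sparse = conclude
  -- The induction starts at the full group of labels, whose cardinality is `q` by `sum-one`.
  (sparse⇒ZeroSum {K = λ _ → true} (<-wellFounded _)
    (record { ε-mem = tt ; ∙-mem = λ _ _ → tt ; ⁻¹-mem = λ _ → tt }) L (λ _ → tt) (sparse′ 100000 sparse))
  where
  open Quotient G H-sub labelling
  open FiniteAbelianGroup quotient-isAbelianGroup
  L = tabulate (π ∘ a)
  sparse′ : ∀ C → C * q * sumSqFibers G π a < n * n * n →
            C * card (λ _ → true) * energy L < length L * length L * length L
  sparse′ C = subst₂ _<_ (cong₂ (λ k E → C * k * E) (sym (sum-one q)) (sumSqFibers≡energy a))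
    (cong (λ m → m * m * m) (sym (length-tabulate (π ∘ a))))
  conclude : ZeroSum L →
             Σ (Subset n) λ S → Nonempty S × (π (subsetSum G S a) ≡ π (AbelianGroup.ε G))
  conclude (x , xs , ys , a↭ , sum≡ε) with realise a (x ∷ xs) ys a↭
  ... | S , inj₁ S≢∅ , eq = S , S≢∅ , trans eq sum≡ε
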